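{- There are infinitely many quartic algebraic integers $\alpha$, i.e. roots of $\alpha^4+a\alpha^3+b\alpha^2+c\alpha+d=0$ with $a,b,c,d\in\mathbb{Z}$ where $\alpha$ has degree $4$ over $\mathbb{Q}$, for which $$\beta=\frac{4\alpha^4}{\alpha^4-1}-\frac{\alpha}{\alpha-1}$$ is a quadratic algebraic number. Moreover, there are infinitely many quartic algebraic numbers $\alpha$ (algebraic numbers of degree $4$ over $\mathbb{Q}$) such that the corresponding $\beta=\frac{4\alpha^4}{\alpha^4-1}-\frac{\alpha}{\alpha-1}$ is a real quadratic algebraic number.
   Context: A quadratic algebraic number is an algebraic number of degree $2$ over $\mathbb{Q}$; it is real quadratic if it is a real number of degree $2$ over $\mathbb{Q}$. -}

module Defs where

open import Data.Nat using (ℕ; _≤_)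
open import Data.Integer using (ℤ; +_)
open import Data.Rational using (ℚ; _+_; _*_; -_; _-_; 0ℚ; 1ℚ; _<_; _/_)
open import Data.List using (List; []; _∷_; _++_; [_]; map; length)
open import Data.Product using (Σ; _×_; _,_; ∃)
open import Relation.Binary.PropositionalEquality using (_≡_; _≢_)
open import Relation.Nullary using (¬_)

-- Polynomials over ℚ as coefficient lists (lowest degree first).

polyAdd : List ℚ → List ℚ → List ℚ
polyAdd []       q        = q
polyAdd (x ∷ p)  []       = x ∷ p
polyAdd (x ∷ p)  (y ∷ q)  = (x + y) ∷ polyAdd p q

polyMul : List ℚ → List ℚ → List ℚ
polyMul []      q = []
polyMul (a ∷ p) q = polyAdd (map (a *_) q) (0ℚ ∷ polyMul p q)

monic : List ℚ → List ℚ
monic cs = cs ++ [ 1ℚ ]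

quartic : ℚ → ℚ → ℚ → ℚ → List ℚ
quartic a b c d = monic (d ∷ c ∷ b ∷ a ∷ [])

-- A monic polynomial over ℚ is reducible iff it is a product of two
-- non-constant polynomials over ℚ; up to scaling by units of ℚ these
-- factors may be taken monic.
ReducibleMonic : List ℚ → Set
ReducibleMonic cs = Σ (List ℚ) λ g → Σ (List ℚ) λ h →
  (1 ≤ length g) × (1 ≤ length h) × (polyMul (monic g) (monic h) ≡ monic cs)

IrreducibleQuartic : ℚ → ℚ → ℚ → ℚ → Set
IrreducibleQuartic a b c d = ¬ ReducibleMonic (d ∷ c ∷ b ∷ a ∷ [])

-- The field ℚ(α) ≅ ℚ[x]/(x⁴ + a x³ + b x² + c x + d) (for an irreducible
-- quartic), elements written in the basis 1, α, α², α³.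

record K : Set where
  constructor ⟨_,_,_,_⟩
  field
    e₀ e₁ e₂ e₃ : ℚ

module Field (a b c d : ℚ) where

  ι : ℚ → K
  ι r = ⟨ r , 0ℚ , 0ℚ , 0ℚ ⟩

  α : K
  α = ⟨ 0ℚ , 1ℚ , 0ℚ , 0ℚ ⟩

  _⊕_ : K → K → K
  ⟨ u₀ , u₁ , u₂ , u₃ ⟩ ⊕ ⟨ v₀ , v₁ , v₂ , v₃ ⟩ =
    ⟨ u₀ + v₀ , u₁ + v₁ , u₂ + v₂ , u₃ + v₃ ⟩

  _·_ : ℚ → K → K
  r · ⟨ u₀ , u₁ , u₂ , u₃ ⟩ = ⟨ r * u₀ , r * u₁ , r * u₂ , r * u₃ ⟩

  ⊖_ : K → K
  ⊖ u = (- 1ℚ) · u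

  _⊝_ : K → K → K
  u ⊝ v = u ⊕ (⊖ v)

  -- multiplication by α, using α⁴ = - (a α³ + b α² + c α + d)
  mulα : K → K
  mulα ⟨ u₀ , u₁ , u₂ , u₃ ⟩ =
    ⟨ - (d * u₃) , u₀ - (c * u₃) , u₁ - (b * u₃) , u₂ - (a * u₃) ⟩

  _⊗_ : K → K → K
  ⟨ u₀ , u₁ , u₂ , u₃ ⟩ ⊗ v =
    (u₀ · v) ⊕ ((u₁ · mulα v) ⊕ ((u₂ · mulα (mulα v)) ⊕ (u₃ · mulα (mulα (mulα v)))))

  α² α⁴ : K
  α² = α ⊗ α
  α⁴ = α² ⊗ α²

  -- β = 4α⁴/(α⁴-1) - α/(α-1)  is characterised (in the field ℚ(α), where
  -- α⁴ ≠ 1 and α ≠ 1) by  β (α⁴-1)(α-1) = 4α⁴(α-1) - α(α⁴-1).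
  IsBeta : K → Set
  IsBeta β =
    β ⊗ ((α⁴ ⊝ ι 1ℚ) ⊗ (α ⊝ ι 1ℚ))
      ≡ (((ι (+ 4 / 1)) ⊗ α⁴) ⊗ (α ⊝ ι 1ℚ)) ⊝ (α ⊗ (α⁴ ⊝ ι 1ℚ))

  -- γ has degree exactly 2 over ℚ with minimal polynomial x² + p x + q:
  -- γ ∉ ℚ (so 1, γ are ℚ-linearly independent) and γ² + p γ + q = 0.
  QuadraticWith : K → ℚ → ℚ → Set
  QuadraticWith γ p q =
    (∀ (r : ℚ) → γ ≢ ι r) × (((γ ⊗ γ) ⊕ (p · γ)) ⊕ ι q ≡ ι 0ℚ)

  Quadratic : K → Set
  Quadratic γ = Σ ℚ λ p → Σ ℚ λ q → QuadraticWith γ p q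

  -- γ is a real quadratic algebraic number: degree 2 and real.  A root of
  -- the minimal polynomial x² + p x + q is real iff p² - 4q > 0.
  RealQuadratic : K → Set
  RealQuadratic γ = Σ ℚ λ p → Σ ℚ λ q →
    QuadraticWith γ p q × (0ℚ < ((p * p) - ((+ 4 / 1) * q)))

GoodQuartic : ℚ → ℚ → ℚ → ℚ → Set
GoodQuartic a b c d =
  IrreducibleQuartic a b c d × ∃ λ β → Field.IsBeta a b c d β × Field.Quadratic a b c d β

GoodQuarticReal : ℚ → ℚ → ℚ → ℚ → Set
GoodQuarticReal a b c d =
  IrreducibleQuartic a b c d × ∃ λ β → Field.IsBeta a b c d β × Field.RealQuadratic a b c d β

ℤ→ℚ : ℤ → ℚ
ℤ→ℚ z = z / 1

{-# OPTIONS --safe #-}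

-- Since 4x⁴/(x⁴ − 1) − x/(x − 1) = f(x) with f(x) = (3x³ + 2x² + x)/(x³ + x² + x + 1), the
-- number α has degree 2 over ℚ(β) exactly when the cubic f(X) = β has a second root in
-- ℚ(β).  Writing that X³ + X² + X + 1 − (X² + 2X + 3)/(3 − β) has a quadratic factor
-- X² − A X + B leads to the conic Y² + 2 (A + 1)² = 2 with Y = A + B − 1.  Its points with
-- A + 1 = x rational and Y = √(2(1 − x²)) give the quartics
--   (t² − (x − 1) t + 2 − x)² = 2 (1 − x²),
-- monic and integral for x ∈ ℤ, and with β ∈ ℚ(Y) real for |x| < 1.
-- Such a quartic is irreducible over ℚ when neither 2(1 − x²) nor
-- x⁴ + 4x³ + 22x² − 28x + 17 is a square.  For x = 3u/(1 + 3k) both become ≡ 2 mod 3 once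
-- the denominator is cleared by an even power of 1 + 3k.
module Submission where

open import Defs
open import Data.Empty using (⊥)
open import Data.Fin using (Fin; zero; suc; toℕ)
open import Data.Fin.Properties using (toℕ-fromℕ<)
open import Data.Integer as ℤ using (ℤ; +_)
import Data.Integer.Divisibility.Signed as ℤ
import Data.Integer.Properties as ℤ
import Data.Integer.Solver as ℤ
open import Data.List using (List; []; _∷_; length; map)
open import Data.List.Properties using (length-++; length-map)
open import Data.Nat as ℕ using (ℕ; suc)
open import Data.Nat.Coprimality using (recompute)
import Data.Nat.Divisibility as ℕ
import Data.Nat.DivMod as ℕ
import Data.Nat.Properties as ℕ
open import Data.Product using (Σ; _×_; _,_; ∃; proj₁; proj₂)
open import Data.Rational
open import Data.Rational.Properties
open import Data.Rational.Solver using (module +-*-Solver)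
import Data.Rational.Unnormalised as ℚᵘ
import Data.Rational.Unnormalised.Properties as ℚᵘ
open import Data.Sum as Sum using (_⊎_; inj₁; inj₂; [_,_]′)
open import Data.Vec as Vec using (Vec)
open import Function using (case_of_)
open import Function.Definitions using (Injective)
open import Relation.Binary.Definitions using (tri<; tri≈; tri>)
open import Relation.Binary.PropositionalEquality
open import Relation.Nullary using (¬_; yes; no; contradiction)

open +-*-Solver
open ≡-Reasoning

-- Notation and elementary facts about rationals

⌜_⌝ : ℕ → ℚ
⌜ n ⌝ = + n / 1

infix 25 #_

#_ : ∀ {n} → ℕ → Polynomial n
# k = con ⌜ k ⌝

Square : ℚ → Set
Square r = ∃ λ z → z * z ≡ r

*-zero⇒zero⊎zero : ∀ r s → r * s ≡ 0ℚ → r ≡ 0ℚ ⊎ s ≡ 0ℚ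
*-zero⇒zero⊎zero r s rs≡0 with r ≟ 0ℚ
... | yes r≡0 = inj₁ r≡0
... | no r≢0 = inj₂ (begin
  s              ≡⟨ *-identityˡ s ⟨
  1ℚ * s         ≡⟨ cong (_* s) (*-inverseˡ r) ⟨
  1/ r * r * s   ≡⟨ *-assoc (1/ r) r s ⟩
  1/ r * (r * s) ≡⟨ cong (1/ r *_) rs≡0 ⟩
  1/ r * 0ℚ      ≡⟨ *-zeroʳ (1/ r) ⟩
  0ℚ             ∎)
  where instance r-nonZero = ≢-nonZero r≢0

nonZero-square-positive : ∀ {r} → r ≢ 0ℚ → Positive (r * r)
nonZero-square-positive {r} r≢0 with <-cmp r 0ℚ
... | tri< r<0 _ _ = neg*neg⇒pos r ⦃ negative r<0 ⦄ r ⦃ negative r<0 ⦄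
... | tri≈ _ r≡0 _ = contradiction r≡0 r≢0
... | tri> _ _ r>0 = pos*pos⇒pos r ⦃ positive r>0 ⦄ r ⦃ positive r>0 ⦄

cong₄ : ∀ {A B : Set} (f : A → A → A → A → B) {a a′ b b′ c c′ d d′} →
        a ≡ a′ → b ≡ b′ → c ≡ c′ → d ≡ d′ → f a b c d ≡ f a′ b′ c′ d′
cong₄ f refl refl refl refl = refl

-- Integers in ℚ

-- `i / 1` is normalised by a gcd, which does not reduce for a variable `i`; the laws for sums and
-- products are therefore checked on unnormalised fractions.
toℚᵘ-ℤ→ℚ : ∀ i → toℚᵘ (ℤ→ℚ i) ℚᵘ.≃ ℚᵘ.mkℚᵘ i 0
toℚᵘ-ℤ→ℚ i = toℚᵘ-fromℚᵘ (ℚᵘ.mkℚᵘ i 0)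

ℤ→ℚ-+ : ∀ i j → ℤ→ℚ (i ℤ.+ j) ≡ ℤ→ℚ i + ℤ→ℚ j
ℤ→ℚ-+ i j = toℚᵘ-injective (R.begin-equality
  toℚᵘ (ℤ→ℚ (i ℤ.+ j))            R.≃⟨ toℚᵘ-ℤ→ℚ (i ℤ.+ j) ⟩
  ℚᵘ.mkℚᵘ (i ℤ.+ j) 0              R.≡⟨ cong₂ (λ k l → ℚᵘ.mkℚᵘ (k ℤ.+ l) 0) (ℤ.*-identityʳ i) (ℤ.*-identityʳ j) ⟨
  ℚᵘ.mkℚᵘ i 0 ℚᵘ.+ ℚᵘ.mkℚᵘ j 0     R.≃⟨ ℚᵘ.+-cong (toℚᵘ-ℤ→ℚ i) (toℚᵘ-ℤ→ℚ j) ⟨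
  toℚᵘ (ℤ→ℚ i) ℚᵘ.+ toℚᵘ (ℤ→ℚ j) R.≃⟨ toℚᵘ-homo-+ (ℤ→ℚ i) (ℤ→ℚ j) ⟨
  toℚᵘ (ℤ→ℚ i + ℤ→ℚ j)           R.∎)
  where module R = ℚᵘ.≤-Reasoning

ℤ→ℚ-* : ∀ i j → ℤ→ℚ (i ℤ.* j) ≡ ℤ→ℚ i * ℤ→ℚ j
ℤ→ℚ-* i j = toℚᵘ-injective (R.begin-equality
  toℚᵘ (ℤ→ℚ (i ℤ.* j))            R.≃⟨ toℚᵘ-ℤ→ℚ (i ℤ.* j) ⟩
  ℚᵘ.mkℚᵘ i 0 ℚᵘ.* ℚᵘ.mkℚᵘ j 0     R.≃⟨ ℚᵘ.*-cong (toℚᵘ-ℤ→ℚ i) (toℚᵘ-ℤ→ℚ j) ⟨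
  toℚᵘ (ℤ→ℚ i) ℚᵘ.* toℚᵘ (ℤ→ℚ j) R.≃⟨ toℚᵘ-homo-* (ℤ→ℚ i) (ℤ→ℚ j) ⟨
  toℚᵘ (ℤ→ℚ i * ℤ→ℚ j)           R.∎)
  where module R = ℚᵘ.≤-Reasoning

ℤ→ℚ-neg : ∀ i → ℤ→ℚ (ℤ.- i) ≡ - ℤ→ℚ i
ℤ→ℚ-neg ℤ.+0       = refl
ℤ→ℚ-neg ℤ.+[1+ n ] = refl
-- A negative numerator over 1 is by definition the negative of a fraction, so a double negation has
-- to be removed.
ℤ→ℚ-neg ℤ.-[1+ n ] = solve 1 (λ r → r := :- (:- r)) refl (ℤ→ℚ (+ suc n))

≡ℤ→ℚ⇒≃ : ∀ {r} i → r ≡ ℤ→ℚ i → toℚᵘ r ℚᵘ.≃ ℚᵘ.mkℚᵘ i 0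
≡ℤ→ℚ⇒≃ i refl = toℚᵘ-ℤ→ℚ i

ℤ→ℚ-injective : Injective _≡_ _≡_ ℤ→ℚ
ℤ→ℚ-injective {i} {j} eq with ℚᵘ.≃-trans (ℚᵘ.≃-sym (toℚᵘ-ℤ→ℚ i)) (≡ℤ→ℚ⇒≃ j eq)
... | ℚᵘ.*≡* i*1≡j*1 = ℤ.*-cancelʳ-≡ i j (+ 1) i*1≡j*1

-- The integer is kept as data: an expression in the operations below yields an integer together
-- with the proof that it maps to the given rational. This serves both the congruences modulo 3 and
-- the integer coefficients of the first family.
Integral : ℚ → Set
Integral r = ∃ λ i → ℤ→ℚ i ≡ r

infixl 6 _+ᴵ_ _-ᴵ_
infixl 7 _*ᴵ_

int : ∀ i → Integral (ℤ→ℚ i)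
int i = i , refl

_+ᴵ_ : ∀ {r s} → Integral r → Integral s → Integral (r + s)
(i , p) +ᴵ (j , q) = i ℤ.+ j , trans (ℤ→ℚ-+ i j) (cong₂ _+_ p q)

_*ᴵ_ : ∀ {r s} → Integral r → Integral s → Integral (r * s)
(i , p) *ᴵ (j , q) = i ℤ.* j , trans (ℤ→ℚ-* i j) (cong₂ _*_ p q)

_-ᴵ_ : ∀ {r s} → Integral r → Integral s → Integral (r - s)
rᴵ -ᴵ (j , q) = rᴵ +ᴵ (ℤ.- j , trans (ℤ→ℚ-neg j) (cong -_ q))

-- Non-squares modulo 3

-- Squares are 0 or 1 modulo 3, so two of them add up to 0 only if both are 0.
3∣a²+b²⇒3∣a×3∣b : ∀ a b → 3 ℕ.∣ a ℕ.* a ℕ.+ b ℕ.* b → 3 ℕ.∣ a × 3 ℕ.∣ b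
3∣a²+b²⇒3∣a×3∣b a b 3∣a²+b² =
  let a≡0 , b≡0 = residues (a ℕ.mod 3) (b ℕ.mod 3) sum≡0
  in 3∣⇐ a a≡0 , 3∣⇐ b b≡0
  where
  residues : ∀ (r s : Fin 3) → (toℕ r ℕ.* toℕ r ℕ.% 3 ℕ.+ toℕ s ℕ.* toℕ s ℕ.% 3) ℕ.% 3 ≡ 0 →
             toℕ r ≡ 0 × toℕ s ≡ 0
  residues zero             zero             _ = refl , refl
  residues zero             (suc zero)       ()
  residues zero             (suc (suc zero)) ()
  residues (suc zero)       zero             ()
  residues (suc zero)       (suc zero)       ()
  residues (suc zero)       (suc (suc zero)) ()
  residues (suc (suc zero)) zero             ()
  residues (suc (suc zero)) (suc zero)       ()
  residues (suc (suc zero)) (suc (suc zero)) ()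

  toℕ-mod : ∀ m → toℕ (m ℕ.mod 3) ≡ m ℕ.% 3
  toℕ-mod m = toℕ-fromℕ< (ℕ.m%n<n m 3)

  3∣⇐ : ∀ m → toℕ (m ℕ.mod 3) ≡ 0 → 3 ℕ.∣ m
  3∣⇐ m m≡0 = ℕ.m%n≡0⇒n∣m m 3 (trans (sym (toℕ-mod m)) m≡0)

  square-mod : ∀ m → toℕ (m ℕ.mod 3) ℕ.* toℕ (m ℕ.mod 3) ℕ.% 3 ≡ m ℕ.* m ℕ.% 3
  square-mod m = trans (cong (λ r → r ℕ.* r ℕ.% 3) (toℕ-mod m)) (sym (ℕ.%-distribˡ-* m m 3))

  sum≡0 = begin
    (toℕ (a ℕ.mod 3) ℕ.* toℕ (a ℕ.mod 3) ℕ.% 3 ℕ.+ toℕ (b ℕ.mod 3) ℕ.* toℕ (b ℕ.mod 3) ℕ.% 3) ℕ.% 3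
      ≡⟨ cong₂ (λ r s → (r ℕ.+ s) ℕ.% 3) (square-mod a) (square-mod b) ⟩
    (a ℕ.* a ℕ.% 3 ℕ.+ b ℕ.* b ℕ.% 3) ℕ.% 3
      ≡⟨ ℕ.%-distribˡ-+ (a ℕ.* a) (b ℕ.* b) 3 ⟨
    (a ℕ.* a ℕ.+ b ℕ.* b) ℕ.% 3
      ≡⟨ ℕ.n∣m⇒m%n≡0 _ 3 3∣a²+b² ⟩
    0 ∎

i*i≡∣i∣*∣i∣ : ∀ i → i ℤ.* i ≡ + (ℤ.∣ i ∣ ℕ.* ℤ.∣ i ∣)
i*i≡∣i∣*∣i∣ (+ n)        = sym (ℤ.pos-* n n)
i*i≡∣i∣*∣i∣ ℤ.-[1+ n ] = refl

-- p² = (2 + 3m) q² gives 3 ∣ p² + q², hence 3 divides both p and q.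
2+3m-nonsquare : ∀ {m} → Integral m → ¬ Square (⌜ 2 ⌝ + ⌜ 3 ⌝ * m)
2+3m-nonsquare mᴵ@(m , refl) (z@(mkℚ p d coprime) , z²≡) =
  case recompute coprime (3∣a²+b²⇒3∣a×3∣b ℤ.∣ p ∣ (suc d) 3∣p²+q²) of λ ()
  where
  q 2+3m : ℤ
  q    = + suc d
  2+3m = proj₁ (int (+ 2) +ᴵ int (+ 3) *ᴵ mᴵ)

  p²≡ : p ℤ.* p ≡ 2+3m ℤ.* (q ℤ.* q)
  p²≡ with ℚᵘ.≃-trans (ℚᵘ.≃-sym (toℚᵘ-homo-* z z))
             (≡ℤ→ℚ⇒≃ 2+3m (trans z²≡ (sym (proj₂ (int (+ 2) +ᴵ int (+ 3) *ᴵ mᴵ)))))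
  ... | ℚᵘ.*≡* eq = trans (sym (ℤ.*-identityʳ (p ℤ.* p))) eq

  3∣p²+q² : 3 ℕ.∣ ℤ.∣ p ∣ ℕ.* ℤ.∣ p ∣ ℕ.+ suc d ℕ.* suc d
  3∣p²+q² = ℤ.∣⇒∣ᵤ (ℤ.divides ((ℤ.1ℤ ℤ.+ m) ℤ.* (q ℤ.* q)) (begin
    + (ℤ.∣ p ∣ ℕ.* ℤ.∣ p ∣) ℤ.+ q ℤ.* q  ≡⟨ cong (ℤ._+ q ℤ.* q) (i*i≡∣i∣*∣i∣ p) ⟨
    p ℤ.* p ℤ.+ q ℤ.* q                  ≡⟨ cong (ℤ._+ q ℤ.* q) p²≡ ⟩
    2+3m ℤ.* (q ℤ.* q) ℤ.+ q ℤ.* q       ≡⟨ factor m (q ℤ.* q) ⟩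
    (ℤ.1ℤ ℤ.+ m) ℤ.* (q ℤ.* q) ℤ.* (+ 3) ∎))
    where
    module S = ℤ.+-*-Solver
    factor = S.solve 2 (λ m q² → (S.con (+ 2) S.:+ S.con (+ 3) S.:* m) S.:* q² S.:+ q²
               S.:= (S.con (+ 1) S.:+ m) S.:* q² S.:* S.con (+ 3)) refl

-- The quartic (t² − (x − 1) t + 2 − x)² − 2 (1 − x²)

a[_] b[_] c[_] d[_] : ℚ → ℚ
a[ x ] = ⌜ 2 ⌝ - ⌜ 2 ⌝ * x
b[ x ] = x * x - ⌜ 4 ⌝ * x + ⌜ 5 ⌝
c[ x ] = ⌜ 2 ⌝ * x * x - ⌜ 6 ⌝ * x + ⌜ 4 ⌝
d[ x ] = ⌜ 3 ⌝ * x * x - ⌜ 4 ⌝ * x + ⌜ 2 ⌝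

a′[_] b′[_] c′[_] d′[_] : ∀ {n} → Polynomial n → Polynomial n
a′[ x ] = # 2 :- # 2 :* x
b′[ x ] = x :* x :- # 4 :* x :+ # 5
c′[ x ] = # 2 :* x :* x :- # 6 :* x :+ # 4
d′[ x ] = # 3 :* x :* x :- # 4 :* x :+ # 2

radicand : ℚ → ℚ
radicand x = ⌜ 2 ⌝ * (1ℚ - x * x)

radicand′ : ∀ {n} → Polynomial n → Polynomial n
radicand′ x = # 2 :* (# 1 :- x :* x)

-- If the quartic is ((t − A/2)² − C)² − n, this is 16 (C² − n), and y⁴ times it is
-- the binary form resolventForm (x y) y.
resolventForm : ℚ → ℚ → ℚ
resolventForm x y = x * x * x * x + ⌜ 4 ⌝ * x * x * x * y + ⌜ 22 ⌝ * x * x * y * y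
                    - ⌜ 28 ⌝ * x * y * y * y + ⌜ 17 ⌝ * y * y * y * y

resolventForm′ : ∀ {n} → Polynomial n → Polynomial n → Polynomial n
resolventForm′ x y = x :* x :* x :* x :+ # 4 :* x :* x :* x :* y :+ # 22 :* x :* x :* y :* y
                     :- # 28 :* x :* y :* y :* y :+ # 17 :* y :* y :* y :* y

resolvent : ℚ → ℚ
resolvent x = resolventForm x 1ℚ

-- Non-squares for x = 3u/(1 + 3k)

module _ (x : ℚ) {k u : ℚ} (kᴵ : Integral k) (uᴵ : Integral u)
         (x[1+3k]≡3u : x * (1ℚ + ⌜ 3 ⌝ * k) ≡ ⌜ 3 ⌝ * u) where
  private
    q : ℚ
    q = 1ℚ + ⌜ 3 ⌝ * k

    qᴵ : Integral q
    qᴵ = int (+ 1) +ᴵ int (+ 3) *ᴵ kᴵ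

  radicand-nonsquare : ¬ Square (radicand x)
  radicand-nonsquare (z , z²≡) = 2+3m-nonsquare
    -- This is m in 2 q² - 2 (3u)² = 2 + 3m, where q = 1 + 3k.
    (int (+ 4) *ᴵ kᴵ +ᴵ int (+ 6) *ᴵ kᴵ *ᴵ kᴵ -ᴵ int (+ 6) *ᴵ uᴵ *ᴵ uᴵ) (z * q , (begin
    z * q * (z * q)
      ≡⟨ solve 2 (λ z q → z :* q :* (z :* q) := (z :* z) :* (q :* q)) refl z q ⟩
    (z * z) * (q * q)
      ≡⟨ cong (_* (q * q)) z²≡ ⟩
    radicand x * (q * q)
      ≡⟨ solve 2 (λ x q → radicand′ x :* (q :* q)
                       := # 2 :* (q :* q) :- # 2 :* ((x :* q) :* (x :* q))) refl x q ⟩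
    ⌜ 2 ⌝ * (q * q) - ⌜ 2 ⌝ * ((x * q) * (x * q))
      ≡⟨ cong (λ y → ⌜ 2 ⌝ * (q * q) - ⌜ 2 ⌝ * (y * y)) x[1+3k]≡3u ⟩
    ⌜ 2 ⌝ * (q * q) - ⌜ 2 ⌝ * ((⌜ 3 ⌝ * u) * (⌜ 3 ⌝ * u))
      ≡⟨ solve 2 (λ k u → let q = # 1 :+ # 3 :* k in
           # 2 :* (q :* q) :- # 2 :* ((# 3 :* u) :* (# 3 :* u))
           := # 2 :+ # 3 :* (# 4 :* k :+ # 6 :* k :* k :- # 6 :* u :* u)) refl k u ⟩
    _ ∎))

  -- In the binary form at (3u, q) every term except 17 q⁴ is divisible by 3, and 17 q⁴ ≡ 17 ≡ 2
  -- modulo 3.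
  resolvent-nonsquare : ¬ Square (resolvent x)
  resolvent-nonsquare (z , z²≡) = 2+3m-nonsquare
    -- First (17 q⁴ - 2)/3 in Horner form in k; the subtracted part collects the terms containing u,
    -- divided by 3.
    (int (+ 5) +ᴵ int (+ 17) *ᴵ kᴵ *ᴵ (int (+ 4) +ᴵ kᴵ *ᴵ (int (+ 18) +ᴵ kᴵ *ᴵ (int (+ 36) +ᴵ int (+ 27) *ᴵ kᴵ)))
     -ᴵ uᴵ *ᴵ (int (+ 28) *ᴵ qᴵ *ᴵ qᴵ *ᴵ qᴵ
               -ᴵ uᴵ *ᴵ (int (+ 66) *ᴵ qᴵ *ᴵ qᴵ +ᴵ uᴵ *ᴵ (int (+ 36) *ᴵ qᴵ +ᴵ int (+ 27) *ᴵ uᴵ))))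
    (z * (q * q) , (begin
    z * (q * q) * (z * (q * q))
      ≡⟨ solve 2 (λ z q → z :* (q :* q) :* (z :* (q :* q)) := (z :* z) :* (q :* q :* q :* q)) refl z q ⟩
    (z * z) * (q * q * q * q)
      ≡⟨ cong (_* (q * q * q * q)) z²≡ ⟩
    resolvent x * (q * q * q * q)
      ≡⟨ solve 2 (λ x q → resolventForm′ x (# 1) :* (q :* q :* q :* q)
                       := resolventForm′ (x :* q) q) refl x q ⟩
    resolventForm (x * q) q
      ≡⟨ cong (λ y → resolventForm y q) x[1+3k]≡3u ⟩
    resolventForm (⌜ 3 ⌝ * u) q
      ≡⟨ solve 2 (λ k u → let q = # 1 :+ # 3 :* k in
           resolventForm′ (# 3 :* u) q
           := # 2 :+ # 3 :* (# 5 :+ # 17 :* k :* (# 4 :+ k :* (# 18 :+ k :* (# 36 :+ # 27 :* k)))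
                             :- u :* (# 28 :* q :* q :* q
                                      :- u :* (# 66 :* q :* q :+ u :* (# 36 :* q :+ # 27 :* u)))))
           refl k u ⟩
    _ ∎))

-- Irreducibility

length-polyAdd : ∀ p q → length (polyAdd p q) ≡ length p ℕ.⊔ length q
length-polyAdd []      q       = refl
length-polyAdd (_ ∷ p) []      = refl
length-polyAdd (_ ∷ p) (_ ∷ q) = cong suc (length-polyAdd p q)

-- Coefficient lists are never trimmed, so length minus one is additive, and the degrees of the
-- factors can be read off without looking at leading coefficients.
length-polyMul : ∀ {m n} p q → length p ≡ suc m → length q ≡ suc n →
                 length (polyMul p q) ≡ suc (m ℕ.+ n)
length-polyMul {n = n} (r ∷ []) q refl eq = begin
  length (polyAdd (map (r *_) q) (0ℚ ∷ [])) ≡⟨ length-polyAdd (map (r *_) q) (0ℚ ∷ []) ⟩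
  length (map (r *_) q) ℕ.⊔ 1               ≡⟨ cong (ℕ._⊔ 1) (trans (length-map (r *_) q) eq) ⟩
  suc (n ℕ.⊔ 0)                             ≡⟨ cong suc (ℕ.⊔-identityʳ n) ⟩
  suc n                                     ∎
length-polyMul {n = n} (r ∷ p@(_ ∷ p′)) q refl eq = begin
  length (polyAdd (map (r *_) q) (0ℚ ∷ polyMul p q))
    ≡⟨ length-polyAdd (map (r *_) q) (0ℚ ∷ polyMul p q) ⟩
  length (map (r *_) q) ℕ.⊔ suc (length (polyMul p q))
    ≡⟨ cong₂ (λ k l → k ℕ.⊔ suc l) (trans (length-map (r *_) q) eq) (length-polyMul p q refl eq) ⟩
  suc (n ℕ.⊔ suc (length p′ ℕ.+ n))
    ≡⟨ cong suc (ℕ.m≤n⇒m⊔n≡n (ℕ.≤-trans (ℕ.m≤n+m n (length p′)) (ℕ.n≤1+n _))) ⟩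
  suc (suc (length p′ ℕ.+ n)) ∎

length-monic : ∀ p → length (monic p) ≡ suc (length p)
length-monic p = trans (length-++ p) (ℕ.+-comm (length p) 1)

quartic-injective : ∀ {a b c d a′ b′ c′ d′ e e′ : ℚ} →
                    d ∷ c ∷ b ∷ a ∷ e ∷ [] ≡ d′ ∷ c′ ∷ b′ ∷ a′ ∷ e′ ∷ [] →
                    d ≡ d′ × c ≡ c′ × b ≡ b′ × a ≡ a′
quartic-injective refl = refl , refl , refl , refl

module _ (x : ℚ) where

  -- A factor t + u gives the root - u, and at a root of z² - `radicand x` the inner quadratic z is
  -- a square root of the radicand.
  no-linear-factor : ¬ Square (radicand x) → ∀ u h₀ h₁ h₂ →
    u * h₀ ≡ d[ x ] → u * h₁ + h₀ ≡ c[ x ] → u * h₂ + h₁ ≡ b[ x ] → u + h₂ ≡ a[ x ] → ⊥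
  no-linear-factor nonsquare u h₀ h₁ h₂ d-eq c-eq b-eq a-eq = nonsquare (z , (begin
    z * z
      ≡⟨ solve 2 (λ x u → let z = u :* u :+ (x :- # 1) :* u :+ # 2 :- x in
           z :* z := radicand′ x :+ (d′[ x ] :- c′[ x ] :* u :+ b′[ x ] :* u :* u :- a′[ x ] :* u :* u :* u :+ u :* u :* u :* u))
           refl x u ⟩
    radicand x + value d[ x ] c[ x ] b[ x ] a[ x ]
      ≡⟨ cong (λ y → radicand x + y) (cong₄ value d-eq c-eq b-eq a-eq) ⟨
    radicand x + value (u * h₀) (u * h₁ + h₀) (u * h₂ + h₁) (u + h₂)
      ≡⟨ solve 5 (λ n u h₀ h₁ h₂ →
           n :+ (u :* h₀ :- (u :* h₁ :+ h₀) :* u :+ (u :* h₂ :+ h₁) :* u :* u :- (u :+ h₂) :* u :* u :* u :+ u :* u :* u :* u)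
           := n) refl (radicand x) u h₀ h₁ h₂ ⟩
    radicand x ∎))
    where
    z : ℚ
    z = u * u + (x - 1ℚ) * u + ⌜ 2 ⌝ - x

    -- the quartic evaluated at − u
    value : ℚ → ℚ → ℚ → ℚ → ℚ
    value d c b a = d - c * u + b * u * u - a * u * u * u + u * u * u * u

  -- For a factorisation (t² + r t + s)(t² + r′ t + s′) put δ = r − r′ and σ = s − s′.  The
  -- coefficient equations force δ (2σ + (x − 1) δ) = 0.  If δ = 0, then σ/2 is a square
  -- root of the radicand, and otherwise z is one of the resolvent.
  module _ (s r s′ r′ : ℚ) (d-eq : s * s′ ≡ d[ x ]) (c-eq : s * r′ + r * s′ ≡ c[ x ])
           (b-eq : s + r * r′ + s′ ≡ b[ x ]) (a-eq : r + r′ ≡ a[ x ]) where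
    private
      δ σ z : ℚ
      δ = r - r′
      σ = s - s′
      -- Obtained by completing the square in δ² in 4 σ² - (x - 1)² δ², with σ² written through δ²
      -- by `h`.
      z = ½ * δ * δ + ⌜ 7 ⌝ - ⌜ 2 ⌝ * x - x * x

      -- With S = s + s′ one has δ σ = a S - 2 c and δ² = a² - 4 (b - S), which gives `g`. Likewise
      -- σ² = S² - 4 d with S = b - (a² - δ²)/4 gives `h`.
      g h : ℚ → ℚ → ℚ → ℚ → ℚ
      g a b c S = ⌜ 2 ⌝ * (a * S - ⌜ 2 ⌝ * c) + (x - 1ℚ) * (a * a - ⌜ 4 ⌝ * (b - S))
      h δ a b d = (b - (a * a - δ * δ) * (½ * ½)) * (b - (a * a - δ * δ) * (½ * ½)) - ⌜ 4 ⌝ * d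

      g′ : ∀ {n} → Polynomial n → Polynomial n → Polynomial n → Polynomial n → Polynomial n → Polynomial n
      g′ x a b c S = # 2 :* (a :* S :- # 2 :* c) :+ (x :- # 1) :* (a :* a :- # 4 :* (b :- S))

      h′ : ∀ {n} → Polynomial n → Polynomial n → Polynomial n → Polynomial n → Polynomial n
      h′ δ a b d = let y = b :- (a :* a :- δ :* δ) :* con (½ * ½) in y :* y :- # 4 :* d

      split : δ * (⌜ 2 ⌝ * σ + (x - 1ℚ) * δ) ≡ 0ℚ
      split = begin
        δ * (⌜ 2 ⌝ * σ + (x - 1ℚ) * δ)
          ≡⟨ solve 5 (λ x s r s′ r′ → let δ = r :- r′ ; σ = s :- s′ in
               δ :* (# 2 :* σ :+ (x :- # 1) :* δ)
               := g′ x (r :+ r′) (s :+ r :* r′ :+ s′) (s :* r′ :+ r :* s′) (s :+ s′)) refl x s r s′ r′ ⟩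
        g (r + r′) (s + r * r′ + s′) (s * r′ + r * s′) (s + s′)
          ≡⟨ cong₄ g a-eq b-eq c-eq (refl {x = s + s′}) ⟩
        -- The quartic is even in t - (x - 1)/2, and this makes `g` vanish for every value of S.
        g a[ x ] b[ x ] c[ x ] (s + s′)
          ≡⟨ solve 2 (λ x S → g′ x a′[ x ] b′[ x ] c′[ x ] S := # 0) refl x (s + s′) ⟩
        0ℚ ∎

      σ² : σ * σ ≡ h δ a[ x ] b[ x ] d[ x ]
      σ² = begin
        σ * σ
          ≡⟨ solve 4 (λ s r s′ r′ → let σ = s :- s′ in
               σ :* σ := h′ (r :- r′) (r :+ r′) (s :+ r :* r′ :+ s′) (s :* s′)) refl s r s′ r′ ⟩
        h δ (r + r′) (s + r * r′ + s′) (s * s′)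
          ≡⟨ cong₄ h (refl {x = δ}) a-eq b-eq d-eq ⟩
        h δ a[ x ] b[ x ] d[ x ] ∎

      -- Factors with a common middle coefficient r multiply to (t² + r t + S/2)² - (σ/2)², where S
      -- = s + s′; this has the shape of the given quartic.
      δ≡0⇒square : δ ≡ 0ℚ → Square (radicand x)
      δ≡0⇒square δ≡0 = ½ * σ , (begin
        ½ * σ * (½ * σ)
          ≡⟨ solve 1 (λ σ → con ½ :* σ :* (con ½ :* σ) := con (½ * ½) :* (σ :* σ)) refl σ ⟩
        ½ * ½ * (σ * σ)
          ≡⟨ cong (½ * ½ *_) (trans σ² (cong (λ δ → h δ a[ x ] b[ x ] d[ x ]) δ≡0)) ⟩
        ½ * ½ * h 0ℚ a[ x ] b[ x ] d[ x ]
          ≡⟨ solve 1 (λ x → con (½ * ½) :* h′ (# 0) a′[ x ] b′[ x ] d′[ x ] := radicand′ x) refl x ⟩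
        radicand x ∎)

      2σ+[x-1]δ≡0⇒square : ⌜ 2 ⌝ * σ + (x - 1ℚ) * δ ≡ 0ℚ → Square (resolvent x)
      2σ+[x-1]δ≡0⇒square eq = z , (begin
        z * z
          ≡⟨ solve 2 (λ x δ → let z = con ½ :* δ :* δ :+ # 7 :- # 2 :* x :- x :* x in
               z :* z := resolventForm′ x (# 1) :+ # 4 :* h′ δ a′[ x ] b′[ x ] d′[ x ]
                         :- (x :- # 1) :* (x :- # 1) :* (δ :* δ)) refl x δ ⟩
        resolvent x + ⌜ 4 ⌝ * h δ a[ x ] b[ x ] d[ x ] - (x - 1ℚ) * (x - 1ℚ) * (δ * δ)
          ≡⟨ cong (λ k → resolvent x + ⌜ 4 ⌝ * k - (x - 1ℚ) * (x - 1ℚ) * (δ * δ)) σ² ⟨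
        resolvent x + ⌜ 4 ⌝ * (σ * σ) - (x - 1ℚ) * (x - 1ℚ) * (δ * δ)
          ≡⟨ solve 4 (λ D x σ δ → D :+ # 4 :* (σ :* σ) :- (x :- # 1) :* (x :- # 1) :* (δ :* δ)
               := D :+ (# 2 :* σ :+ (x :- # 1) :* δ) :* (# 2 :* σ :- (x :- # 1) :* δ))
               refl (resolvent x) x σ δ ⟩
        resolvent x + (⌜ 2 ⌝ * σ + (x - 1ℚ) * δ) * (⌜ 2 ⌝ * σ - (x - 1ℚ) * δ)
          ≡⟨ cong (λ k → resolvent x + k * (⌜ 2 ⌝ * σ - (x - 1ℚ) * δ)) eq ⟩
        resolvent x + 0ℚ * (⌜ 2 ⌝ * σ - (x - 1ℚ) * δ)
          ≡⟨ solve 2 (λ D k → D :+ # 0 :* k := D) refl (resolvent x) (⌜ 2 ⌝ * σ - (x - 1ℚ) * δ) ⟩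
        resolvent x ∎)

    quadratic-factors⇒square : Square (radicand x) ⊎ Square (resolvent x)
    quadratic-factors⇒square =
      Sum.map δ≡0⇒square 2σ+[x-1]δ≡0⇒square (*-zero⇒zero⊎zero δ (⌜ 2 ⌝ * σ + (x - 1ℚ) * δ) split)

  irreducible : ¬ Square (radicand x) → ¬ Square (resolvent x) →
                IrreducibleQuartic a[ x ] b[ x ] c[ x ] d[ x ]
  irreducible n-nonsquare r-nonsquare (g , h , 1≤g , 1≤h , gh≡) = factors g h 1≤g 1≤h degrees gh≡
    where
    degrees : length g ℕ.+ length h ≡ 4
    degrees = ℕ.suc-injective (trans
      (sym (length-polyMul (monic g) (monic h) (length-monic g) (length-monic h)))
      (cong length gh≡))

    factors : ∀ g h → 1 ℕ.≤ length g → 1 ℕ.≤ length h → length g ℕ.+ length h ≡ 4 →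
              polyMul (monic g) (monic h) ≢ quartic a[ x ] b[ x ] c[ x ] d[ x ]
    factors [] _ ()
    factors _ [] _ ()
    factors (u ∷ []) (h₀ ∷ h₁ ∷ h₂ ∷ []) _ _ refl gh≡ =
      let e₀ , e₁ , e₂ , e₃ = quartic-injective gh≡ in
      no-linear-factor n-nonsquare u h₀ h₁ h₂
        -- `polyMul` leaves factors 1 and trailing zeros from its shifted tails; the solver calls
        -- remove them.
        (trans (solve 2 (λ u h₀ → u :* h₀ := u :* h₀ :+ # 0) refl u h₀) e₀)
        (trans (solve 3 (λ u h₀ h₁ → u :* h₁ :+ h₀ := u :* h₁ :+ (# 1 :* h₀ :+ # 0)) refl u h₀ h₁) e₁)
        (trans (solve 3 (λ u h₁ h₂ → u :* h₂ :+ h₁ := u :* h₂ :+ # 1 :* h₁) refl u h₁ h₂) e₂)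
        (trans (solve 2 (λ u h₂ → u :+ h₂ := u :* # 1 :+ # 1 :* h₂) refl u h₂) e₃)
    factors (s ∷ r ∷ []) (s′ ∷ r′ ∷ []) _ _ refl gh≡ =
      let e₀ , e₁ , e₂ , e₃ = quartic-injective gh≡ in
      [ n-nonsquare , r-nonsquare ]′ (quadratic-factors⇒square s r s′ r′
        (trans (solve 2 (λ s s′ → s :* s′ := s :* s′ :+ # 0) refl s s′) e₀)
        (trans (solve 4 (λ s r s′ r′ → s :* r′ :+ r :* s′ := s :* r′ :+ (r :* s′ :+ # 0)) refl s r s′ r′) e₁)
        (trans (solve 4 (λ s r s′ r′ → s :+ r :* r′ :+ s′ := s :* # 1 :+ (r :* r′ :+ (# 1 :* s′ :+ # 0))) refl s r s′ r′) e₂)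
        (trans (solve 2 (λ r r′ → r :+ r′ := r :* # 1 :+ # 1 :* r′) refl r r′) e₃))
    factors (h₀ ∷ h₁ ∷ h₂ ∷ []) (u ∷ []) _ _ refl gh≡ =
      let e₀ , e₁ , e₂ , e₃ = quartic-injective gh≡ in
      no-linear-factor n-nonsquare u h₀ h₁ h₂
        (trans (solve 2 (λ u h₀ → u :* h₀ := h₀ :* u :+ # 0) refl u h₀) e₀)
        (trans (solve 3 (λ u h₀ h₁ → u :* h₁ :+ h₀ := h₀ :* # 1 :+ (h₁ :* u :+ # 0)) refl u h₀ h₁) e₁)
        (trans (solve 3 (λ u h₁ h₂ → u :* h₂ :+ h₁ := h₁ :* # 1 :+ (h₂ :* u :+ # 0)) refl u h₁ h₂) e₂)
        (trans (solve 2 (λ u h₂ → u :+ h₂ := h₂ :* # 1 :+ (# 1 :* u :+ # 0)) refl u h₂) e₃)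
    -- The lengths now add up to at least 5; cancelling 4 leaves a successor equal to 0.
    factors (_ ∷ _ ∷ _ ∷ _ ∷ g) (_ ∷ h) _ _ degrees _ =
      case trans (sym (ℕ.+-suc (length g) (length h))) (ℕ.+-cancelˡ-≡ 4 _ _ degrees) of λ ()

-- Computations in ℚ(α)

K-≡ : ∀ {u v : K} → K.e₀ u ≡ K.e₀ v → K.e₁ u ≡ K.e₁ v → K.e₂ u ≡ K.e₂ v → K.e₃ u ≡ K.e₃ v → u ≡ v
K-≡ = cong₄ ⟨_,_,_,_⟩

-- Solver expressions for elements of K.  The operations copy those of Defs.Field, so that
-- evaluating them yields the latter definitionally.
record K′ (n : ℕ) : Set where
  constructor ⟪_,_,_,_⟫
  field
    e₀ e₁ e₂ e₃ : Polynomial n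

module Field′ {n : ℕ} (a b c d : Polynomial n) where

  ι′ : Polynomial n → K′ n
  ι′ r = ⟪ r , # 0 , # 0 , # 0 ⟫

  α′ : K′ n
  α′ = ⟪ # 0 , # 1 , # 0 , # 0 ⟫

  _⊕′_ : K′ n → K′ n → K′ n
  ⟪ u₀ , u₁ , u₂ , u₃ ⟫ ⊕′ ⟪ v₀ , v₁ , v₂ , v₃ ⟫ =
    ⟪ u₀ :+ v₀ , u₁ :+ v₁ , u₂ :+ v₂ , u₃ :+ v₃ ⟫

  _·′_ : Polynomial n → K′ n → K′ n
  r ·′ ⟪ u₀ , u₁ , u₂ , u₃ ⟫ = ⟪ r :* u₀ , r :* u₁ , r :* u₂ , r :* u₃ ⟫

  _⊝′_ : K′ n → K′ n → K′ n
  u ⊝′ v = u ⊕′ ((:- # 1) ·′ v)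

  mulα′ : K′ n → K′ n
  mulα′ ⟪ u₀ , u₁ , u₂ , u₃ ⟫ =
    ⟪ :- (d :* u₃) , u₀ :- (c :* u₃) , u₁ :- (b :* u₃) , u₂ :- (a :* u₃) ⟫

  _⊗′_ : K′ n → K′ n → K′ n
  ⟪ u₀ , u₁ , u₂ , u₃ ⟫ ⊗′ v =
    (u₀ ·′ v) ⊕′ ((u₁ ·′ mulα′ v) ⊕′ ((u₂ ·′ mulα′ (mulα′ v)) ⊕′ (u₃ ·′ mulα′ (mulα′ (mulα′ v)))))

  -- Precomputed coordinates, which keep the later polynomial identities small.
  α⁴′ [α⁴-1][α-1]′ α⁴-4α+3′ : K′ n
  α⁴′          = ⟪ :- d , :- c , :- b , :- a ⟫
  [α⁴-1][α-1]′ = ⟪ a :* d :+ d :+ # 1 , a :* c :- d :+ c :- # 1 , a :* b :- c :+ b , a :* a :- b :+ a ⟫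
  α⁴-4α+3′     = ⟪ # 3 :- d , :- (c :+ # 4) , :- b , :- a ⟫

⟦_⟧K ⟦_⟧K↓ : ∀ {n} → K′ n → Vec ℚ n → K
⟦ ⟪ u₀ , u₁ , u₂ , u₃ ⟫ ⟧K  ρ = ⟨ ⟦ u₀ ⟧ ρ , ⟦ u₁ ⟧ ρ , ⟦ u₂ ⟧ ρ , ⟦ u₃ ⟧ ρ ⟩
⟦ ⟪ u₀ , u₁ , u₂ , u₃ ⟫ ⟧K↓ ρ = ⟨ ⟦ u₀ ⟧↓ ρ , ⟦ u₁ ⟧↓ ρ , ⟦ u₂ ⟧↓ ρ , ⟦ u₃ ⟧↓ ρ ⟩

proveK : ∀ {n} (ρ : Vec ℚ n) (u v : K′ n) → ⟦ u ⟧K↓ ρ ≡ ⟦ v ⟧K↓ ρ → ⟦ u ⟧K ρ ≡ ⟦ v ⟧K ρ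
proveK ρ ⟪ u₀ , u₁ , u₂ , u₃ ⟫ ⟪ v₀ , v₁ , v₂ , v₃ ⟫ eq =
  K-≡ (prove ρ u₀ v₀ (cong K.e₀ eq)) (prove ρ u₁ v₁ (cong K.e₁ eq))
      (prove ρ u₂ v₂ (cong K.e₂ eq)) (prove ρ u₃ v₃ (cong K.e₃ eq))

module _ (a b c d : ℚ) where
  open Field a b c d

  private
    ρ : Vec ℚ 4
    ρ = a Vec.∷ b Vec.∷ c Vec.∷ d Vec.∷ Vec.[]

    open Field′ {4} (var zero) (var (suc zero)) (var (suc (suc zero))) (var (suc (suc (suc zero))))

  [α⁴-1][α-1] α⁴-4α+3 : K
  [α⁴-1][α-1] = ⟨ a * d + d + 1ℚ , a * c - d + c - 1ℚ , a * b - c + b , a * a - b + a ⟩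
  α⁴-4α+3     = ⟨ ⌜ 3 ⌝ - d , - (c + ⌜ 4 ⌝) , - b , - a ⟩

  α⁴-coordinates : α⁴ ≡ ⟨ - d , - c , - b , - a ⟩
  α⁴-coordinates = proveK ρ ((α′ ⊗′ α′) ⊗′ (α′ ⊗′ α′)) α⁴′ refl

  β-denominator : (α⁴ ⊝ ι 1ℚ) ⊗ (α ⊝ ι 1ℚ) ≡ [α⁴-1][α-1]
  β-denominator = trans
    (cong (λ u → (u ⊝ ι 1ℚ) ⊗ (α ⊝ ι 1ℚ)) α⁴-coordinates)
    (proveK ρ ((α⁴′ ⊝′ ι′ (# 1)) ⊗′ (α′ ⊝′ ι′ (# 1))) [α⁴-1][α-1]′ refl)

  -- Division with remainder: β = 3 - (α⁴ - 4α + 3)/((α⁴ - 1)(α - 1)). Cancelling (α - 1)² turns the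
  -- fraction into (α² + 2α + 3)/(α³ + α² + α + 1).
  β-numerator : ((ι ⌜ 4 ⌝ ⊗ α⁴) ⊗ (α ⊝ ι 1ℚ)) ⊝ (α ⊗ (α⁴ ⊝ ι 1ℚ))
                ≡ (⌜ 3 ⌝ · [α⁴-1][α-1]) ⊝ α⁴-4α+3
  β-numerator = trans
    (cong (λ u → ((ι ⌜ 4 ⌝ ⊗ u) ⊗ (α ⊝ ι 1ℚ)) ⊝ (α ⊗ (u ⊝ ι 1ℚ))) α⁴-coordinates)
    (proveK ρ (((ι′ (# 4) ⊗′ α⁴′) ⊗′ (α′ ⊝′ ι′ (# 1))) ⊝′ (α′ ⊗′ (α⁴′ ⊝′ ι′ (# 1))))
              ((# 3 ·′ [α⁴-1][α-1]′) ⊝′ α⁴-4α+3′) refl)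

  ⊕-zeroMultiple : ∀ u v → u ⊕ (0ℚ · v) ≡ u
  ⊕-zeroMultiple ⟨ u₀ , u₁ , u₂ , u₃ ⟩ ⟨ v₀ , v₁ , v₂ , v₃ ⟩ =
    K-≡ (eq u₀ v₀) (eq u₁ v₁) (eq u₂ v₂) (eq u₃ v₃)
    where
    eq : ∀ r s → r + 0ℚ * s ≡ r
    eq = solve 2 (λ r s → r :+ # 0 :* s := r) refl

-- Here w = 1/((x − 1)(x² + 1)).  Solving the cubic for 1/(3 − β) gives
-- β = 3 − w (x² − 1 + Y), where Y = − (α² − (x − 1) α + 2 − x) has Y² = radicand x.
module _ (x w : ℚ) where
  open Field a[ x ] b[ x ] c[ x ] d[ x ]

  private
    ρ : Vec ℚ 2
    ρ = x Vec.∷ w Vec.∷ Vec.[]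

    x′ w′ r′ : Polynomial 2
    x′ = var zero
    w′ = var (suc zero)
    r′ = # 3 :- w′ :* (x′ :* x′ :- # 1)

    open Field′ a′[ x′ ] b′[ x′ ] c′[ x′ ] d′[ x′ ]

    β′ : K′ 2
    β′ = ⟪ # 3 :- w′ :* (x′ :* x′ :+ x′ :- # 3) , :- (w′ :* (x′ :- # 1)) , w′ , # 0 ⟫

    r : ℚ
    r = ⌜ 3 ⌝ - w * (x * x - 1ℚ)

  M : ℚ
  M = (x - 1ℚ) * (x * x + 1ℚ)

  β : K
  β = ⟨ ⌜ 3 ⌝ - w * (x * x + x - ⌜ 3 ⌝) , - (w * (x - 1ℚ)) , w , 0ℚ ⟩

  -- Since β = r - w Y, these are the coefficients of (T - r)² - w² `radicand x`.
  p q : ℚ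
  p = - ⌜ 2 ⌝ * r
  q = r * r - w * w * radicand x

  β-quadratic : w ≢ 0ℚ → QuadraticWith β p q
  -- The α² coordinate of β is w, while that of a rational is 0.
  β-quadratic w≢0 = (λ r β≡ιr → w≢0 (cong K.e₂ β≡ιr)) ,
    proveK ρ (((β′ ⊗′ β′) ⊕′ ((con (- ⌜ 2 ⌝) :* r′) ·′ β′)) ⊕′ ι′ (r′ :* r′ :- w′ :* w′ :* radicand′ x′))
             (ι′ (# 0)) refl

  β-discriminant : p * p - ⌜ 4 ⌝ * q ≡ ⌜ 4 ⌝ * (w * w) * radicand x
  β-discriminant = solve 2 (λ x w → let r = # 3 :- w :* (x :* x :- # 1) in
    (con (- ⌜ 2 ⌝) :* r) :* (con (- ⌜ 2 ⌝) :* r) :- # 4 :* (r :* r :- w :* w :* radicand′ x)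
    := # 4 :* (w :* w) :* radicand′ x) refl x w

  private
    V D : K
    V = [α⁴-1][α-1] a[ x ] b[ x ] c[ x ] d[ x ]
    D = α⁴-4α+3 a[ x ] b[ x ] c[ x ] d[ x ]

    -- The solver treats `w` as a free variable, so the deviation from w M = 1 stays visible as a
    -- multiple of D, to be removed in `isBeta`.
    β⊗V : β ⊗ V ≡ ((⌜ 3 ⌝ · V) ⊝ D) ⊕ ((1ℚ - w * M) · D)
    β⊗V = proveK ρ (β′ ⊗′ [α⁴-1][α-1]′)
      (((# 3 ·′ [α⁴-1][α-1]′) ⊝′ α⁴-4α+3′)
       ⊕′ ((# 1 :- w′ :* ((x′ :- # 1) :* (x′ :* x′ :+ # 1))) ·′ α⁴-4α+3′)) refl

  isBeta : w * M ≡ 1ℚ → IsBeta β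
  isBeta wM≡1 =
    trans (cong (β ⊗_) (β-denominator a[ x ] b[ x ] c[ x ] d[ x ]))
    (trans β⊗V
    (trans (cong (λ y → ((⌜ 3 ⌝ · V) ⊝ D) ⊕ ((1ℚ - y) · D)) wM≡1)
    (trans (⊕-zeroMultiple a[ x ] b[ x ] c[ x ] d[ x ] ((⌜ 3 ⌝ · V) ⊝ D) D)
           (sym (β-numerator a[ x ] b[ x ] c[ x ] d[ x ])))))

-- Good quartics from a parameter x

module _ (x : ℚ) (n-nonsquare : ¬ Square (radicand x)) (r-nonsquare : ¬ Square (resolvent x)) where
  private
    -- radicand x would be 0² if x = 1, and 2² if x² = −1
    [x-1][x²+1]≢0 : (x - 1ℚ) * (x * x + 1ℚ) ≢ 0ℚ
    [x-1][x²+1]≢0 M≡0 = [ x-1≢0 , x²+1≢0 ]′ (*-zero⇒zero⊎zero (x - 1ℚ) (x * x + 1ℚ) M≡0)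
      where
      x-1≢0 : x - 1ℚ ≢ 0ℚ
      x-1≢0 eq = n-nonsquare (0ℚ , (begin
        0ℚ                              ≡⟨ *-zeroˡ (- ⌜ 2 ⌝ * (x + 1ℚ)) ⟨
        0ℚ * (- ⌜ 2 ⌝ * (x + 1ℚ))       ≡⟨ cong (_* (- ⌜ 2 ⌝ * (x + 1ℚ))) eq ⟨
        (x - 1ℚ) * (- ⌜ 2 ⌝ * (x + 1ℚ)) ≡⟨ solve 1 (λ x → (x :- # 1) :* (con (- ⌜ 2 ⌝) :* (x :+ # 1)) := radicand′ x) refl x ⟩
        radicand x                      ∎))

      x²+1≢0 : x * x + 1ℚ ≢ 0ℚ
      x²+1≢0 eq = n-nonsquare (⌜ 2 ⌝ , (begin
        ⌜ 4 ⌝ - ⌜ 2 ⌝ * 0ℚ           ≡⟨ cong (λ y → ⌜ 4 ⌝ - ⌜ 2 ⌝ * y) eq ⟨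
        ⌜ 4 ⌝ - ⌜ 2 ⌝ * (x * x + 1ℚ) ≡⟨ solve 1 (λ x → # 4 :- # 2 :* (x :* x :+ # 1) := radicand′ x) refl x ⟩
        radicand x                   ∎))

    w : ℚ
    w = (1/ ((x - 1ℚ) * (x * x + 1ℚ))) ⦃ ≢-nonZero [x-1][x²+1]≢0 ⦄

    wM≡1 : w * ((x - 1ℚ) * (x * x + 1ℚ)) ≡ 1ℚ
    wM≡1 = *-inverseˡ ((x - 1ℚ) * (x * x + 1ℚ)) ⦃ ≢-nonZero [x-1][x²+1]≢0 ⦄

    w≢0 : w ≢ 0ℚ
    w≢0 w≡0 = contradiction
      (trans (sym wM≡1) (trans (cong (_* ((x - 1ℚ) * (x * x + 1ℚ))) w≡0) (*-zeroˡ ((x - 1ℚ) * (x * x + 1ℚ))))) 1≢0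

  goodQuartic : GoodQuartic a[ x ] b[ x ] c[ x ] d[ x ]
  goodQuartic = irreducible x n-nonsquare r-nonsquare ,
    β x w , isBeta x w wM≡1 , p x w , q x w , β-quadratic x w w≢0

  goodQuarticReal : Positive (radicand x) → GoodQuarticReal a[ x ] b[ x ] c[ x ] d[ x ]
  goodQuarticReal n>0 = irreducible x n-nonsquare r-nonsquare ,
    β x w , isBeta x w wM≡1 , p x w , q x w , β-quadratic x w w≢0 ,
    subst (0ℚ <_) (sym (β-discriminant x w)) (positive⁻¹ _
      ⦃ pos*pos⇒pos (⌜ 4 ⌝ * (w * w)) ⦃ pos*pos⇒pos ⌜ 4 ⌝ (w * w) ⦃ nonZero-square-positive w≢0 ⦄ ⦄
                    (radicand x) ⦃ n>0 ⦄ ⦄)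

-- The cubic coefficient alone determines x, so distinct parameters give distinct quartics.
a[]-injective : Injective _≡_ _≡_ a[_]
a[]-injective {x} {y} eq = begin
  x                   ≡⟨ solve 1 (λ x → x := # 1 :- con ½ :* a′[ x ]) refl x ⟩
  1ℚ - ½ * a[ x ]     ≡⟨ cong (λ a → 1ℚ - ½ * a) eq ⟩
  1ℚ - ½ * a[ y ]     ≡⟨ solve 1 (λ x → # 1 :- con ½ :* a′[ x ] := x) refl y ⟩
  y                   ∎

-- The integral family

-- Multiples of 3 are the case k = 0, u = j of the congruence argument.
xℤ : ℕ → ℚ
xℤ j = ⌜ 3 ⌝ * ⌜ j ⌝

aᴵ : ∀ {x} → Integral x → Integral a[ x ]
aᴵ xᴵ = int (+ 2) -ᴵ int (+ 2) *ᴵ xᴵ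

bᴵ : ∀ {x} → Integral x → Integral b[ x ]
bᴵ xᴵ = xᴵ *ᴵ xᴵ -ᴵ int (+ 4) *ᴵ xᴵ +ᴵ int (+ 5)

cᴵ : ∀ {x} → Integral x → Integral c[ x ]
cᴵ xᴵ = int (+ 2) *ᴵ xᴵ *ᴵ xᴵ -ᴵ int (+ 6) *ᴵ xᴵ +ᴵ int (+ 4)

dᴵ : ∀ {x} → Integral x → Integral d[ x ]
dᴵ xᴵ = int (+ 3) *ᴵ xᴵ *ᴵ xᴵ -ᴵ int (+ 4) *ᴵ xᴵ +ᴵ int (+ 2)

goodQuartic-integral : ∀ {a b c d} ((a₀ , _) : Integral a) ((b₀ , _) : Integral b)
  ((c₀ , _) : Integral c) ((d₀ , _) : Integral d) →
  GoodQuartic a b c d → GoodQuartic (ℤ→ℚ a₀) (ℤ→ℚ b₀) (ℤ→ℚ c₀) (ℤ→ℚ d₀)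
goodQuartic-integral (_ , refl) (_ , refl) (_ , refl) (_ , refl) good = good

xℤ-integral : ∀ j → Integral (xℤ j)
xℤ-integral j = int (+ 3) *ᴵ int (+ j)

xℤ-injective : Injective _≡_ _≡_ xℤ
xℤ-injective {i} {j} eq = ℤ.+-injective (ℤ→ℚ-injective (*-cancelˡ-3 eq))
  where
  *-cancelˡ-3 : ∀ {r s} → ⌜ 3 ⌝ * r ≡ ⌜ 3 ⌝ * s → r ≡ s
  *-cancelˡ-3 {r} {s} eq = begin
    r                     ≡⟨ solve 1 (λ r → r := con (+ 1 / 3) :* (# 3 :* r)) refl r ⟩
    + 1 / 3 * (⌜ 3 ⌝ * r) ≡⟨ cong (+ 1 / 3 *_) eq ⟩
    + 1 / 3 * (⌜ 3 ⌝ * s) ≡⟨ solve 1 (λ r → con (+ 1 / 3) :* (# 3 :* r) := r) refl s ⟩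
    s                     ∎

goodQuartic-xℤ : ∀ j → GoodQuartic a[ xℤ j ] b[ xℤ j ] c[ xℤ j ] d[ xℤ j ]
goodQuartic-xℤ j = goodQuartic (xℤ j)
  (radicand-nonsquare (xℤ j) (int (+ 0)) (int (+ j)) (*-identityʳ (xℤ j)))
  (resolvent-nonsquare (xℤ j) (int (+ 0)) (int (+ j)) (*-identityʳ (xℤ j)))

-- The real family x = 3/(4 + 3j)

module Real (j : ℕ) where

  -- Kept in the shape 1 + 3k, with k = 1 + j and u = 1. It is at least 4, hence 0 < x < 1.
  denominator : ℚ
  denominator = 1ℚ + ⌜ 3 ⌝ * (1ℚ + ⌜ j ⌝)

  instance
    j-nonNegative : NonNegative ⌜ j ⌝
    j-nonNegative = normalize-nonNeg j 1

    1+j-nonNegative : NonNegative (1ℚ + ⌜ j ⌝)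
    1+j-nonNegative = pos⇒nonNeg (1ℚ + ⌜ j ⌝) ⦃ pos+nonNeg⇒pos 1ℚ ⌜ j ⌝ ⦄

    denominator-positive : Positive denominator
    denominator-positive =
      pos+nonNeg⇒pos 1ℚ (⌜ 3 ⌝ * (1ℚ + ⌜ j ⌝)) ⦃ nonNeg*nonNeg⇒nonNeg ⌜ 3 ⌝ (1ℚ + ⌜ j ⌝) ⦄

    denominator-nonZero : NonZero denominator
    denominator-nonZero = pos⇒nonZero denominator

  x : ℚ
  x = ⌜ 3 ⌝ * 1/ denominator

  x*denominator≡3 : x * denominator ≡ ⌜ 3 ⌝
  x*denominator≡3 = trans (*-assoc ⌜ 3 ⌝ (1/ denominator) denominator) (cong (⌜ 3 ⌝ *_) (*-inverseˡ denominator))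

  -- Multiplying by the squared denominator gives 2 (4 + 3j)² - 18, a polynomial in j with positive
  -- coefficients.
  radicand-positive : Positive (radicand x)
  radicand-positive = positive {radicand x} (*-cancelʳ-<-nonNeg (denominator * denominator)
    ⦃ pos⇒nonNeg (denominator * denominator) ⦃ pos*pos⇒pos denominator denominator ⦄ ⦄ {0ℚ} {radicand x}
    (subst₂ _<_ (sym (*-zeroˡ (denominator * denominator))) (sym scaled)
      (positive⁻¹ (⌜ 14 ⌝ + ⌜ j ⌝ * (⌜ 48 ⌝ + ⌜ 18 ⌝ * ⌜ j ⌝)) ⦃ scaled-positive ⦄)))
    where
    scaled : radicand x * (denominator * denominator) ≡ ⌜ 14 ⌝ + ⌜ j ⌝ * (⌜ 48 ⌝ + ⌜ 18 ⌝ * ⌜ j ⌝)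
    scaled = begin
      radicand x * (denominator * denominator)
        ≡⟨ solve 2 (λ x q → radicand′ x :* (q :* q)
                         := # 2 :* (q :* q) :- # 2 :* ((x :* q) :* (x :* q))) refl x denominator ⟩
      ⌜ 2 ⌝ * (denominator * denominator) - ⌜ 2 ⌝ * ((x * denominator) * (x * denominator))
        ≡⟨ cong (λ y → ⌜ 2 ⌝ * (denominator * denominator) - ⌜ 2 ⌝ * (y * y)) x*denominator≡3 ⟩
      ⌜ 2 ⌝ * (denominator * denominator) - ⌜ 2 ⌝ * (⌜ 3 ⌝ * ⌜ 3 ⌝)
        ≡⟨ solve 1 (λ j → let q = # 1 :+ # 3 :* (# 1 :+ j) in
             # 2 :* (q :* q) :- # 2 :* (# 3 :* # 3) := # 14 :+ j :* (# 48 :+ # 18 :* j)) refl ⌜ j ⌝ ⟩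
      ⌜ 14 ⌝ + ⌜ j ⌝ * (⌜ 48 ⌝ + ⌜ 18 ⌝ * ⌜ j ⌝) ∎

    scaled-positive : Positive (⌜ 14 ⌝ + ⌜ j ⌝ * (⌜ 48 ⌝ + ⌜ 18 ⌝ * ⌜ j ⌝))
    scaled-positive = pos+nonNeg⇒pos ⌜ 14 ⌝ (⌜ j ⌝ * (⌜ 48 ⌝ + ⌜ 18 ⌝ * ⌜ j ⌝))
      ⦃ nonNeg*nonNeg⇒nonNeg ⌜ j ⌝ (⌜ 48 ⌝ + ⌜ 18 ⌝ * ⌜ j ⌝)
        ⦃ pos⇒nonNeg (⌜ 48 ⌝ + ⌜ 18 ⌝ * ⌜ j ⌝)
          ⦃ pos+nonNeg⇒pos ⌜ 48 ⌝ (⌜ 18 ⌝ * ⌜ j ⌝) ⦃ nonNeg*nonNeg⇒nonNeg ⌜ 18 ⌝ ⌜ j ⌝ ⦄ ⦄ ⦄ ⦄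

  good : GoodQuarticReal a[ x ] b[ x ] c[ x ] d[ x ]
  good = goodQuarticReal x
    (radicand-nonsquare x (int (+ 1) +ᴵ int (+ j)) (int (+ 1)) x*denominator≡3)
    (resolvent-nonsquare x (int (+ 1) +ᴵ int (+ j)) (int (+ 1)) x*denominator≡3)
    radicand-positive

xℝ-injective : Injective _≡_ _≡_ Real.x
xℝ-injective {i} {j} eq = ℤ.+-injective (ℤ→ℚ-injective (begin
  ⌜ i ⌝            ≡⟨ solve 1 (λ i → i := undo′ (# 1 :+ # 3 :* (# 1 :+ i))) refl ⌜ i ⌝ ⟩
  undo I.denominator ≡⟨ cong undo denominators ⟩
  undo J.denominator ≡⟨ solve 1 (λ i → undo′ (# 1 :+ # 3 :* (# 1 :+ i)) := i) refl ⌜ j ⌝ ⟩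
  ⌜ j ⌝            ∎))
  where
  module I = Real i
  module J = Real j

  undo : ℚ → ℚ
  undo q = + 1 / 3 * (q - ⌜ 4 ⌝)

  undo′ : ∀ {n} → Polynomial n → Polynomial n
  undo′ q = con (+ 1 / 3) :* (q :- # 4)

  -- Both denominators times the common x give 3, so each equals (1/3) x times the product of the
  -- two.
  denominators : I.denominator ≡ J.denominator
  denominators = begin
    I.denominator
      ≡⟨ solve 1 (λ q → q := con (+ 1 / 3) :* # 3 :* q) refl I.denominator ⟩
    + 1 / 3 * ⌜ 3 ⌝ * I.denominator
      ≡⟨ cong (λ y → + 1 / 3 * y * I.denominator) J.x*denominator≡3 ⟨
    + 1 / 3 * (J.x * J.denominator) * I.denominator
      ≡⟨ solve 3 (λ x q q′ → con (+ 1 / 3) :* (x :* q) :* q′ := con (+ 1 / 3) :* (x :* q′) :* q)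
           refl J.x J.denominator I.denominator ⟩
    + 1 / 3 * (J.x * I.denominator) * J.denominator
      ≡⟨ cong (λ y → + 1 / 3 * (y * I.denominator) * J.denominator) eq ⟨
    + 1 / 3 * (I.x * I.denominator) * J.denominator
      ≡⟨ cong (λ y → + 1 / 3 * y * J.denominator) I.x*denominator≡3 ⟩
    + 1 / 3 * ⌜ 3 ⌝ * J.denominator
      ≡⟨ solve 1 (λ q → con (+ 1 / 3) :* # 3 :* q := q) refl J.denominator ⟩
    J.denominator ∎

theorem1p1 : (Σ (ℕ → ℤ × ℤ × ℤ × ℤ) λ F → Injective _≡_ _≡_ F ×
    (∀ n → let (a , b , c , d) = F n in
    GoodQuartic (ℤ→ℚ a) (ℤ→ℚ b) (ℤ→ℚ c) (ℤ→ℚ d)))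
    ×
    (Σ (ℕ → ℚ × ℚ × ℚ × ℚ) λ G → Injective _≡_ _≡_ G ×
    (∀ n → let (a , b , c , d) = G n in GoodQuarticReal a b c d))
theorem1p1 =
  ( (λ j → let xᴵ = xℤ-integral j in proj₁ (aᴵ xᴵ) , proj₁ (bᴵ xᴵ) , proj₁ (cᴵ xᴵ) , proj₁ (dᴵ xᴵ))
  , (λ {i} {j} eq → xℤ-injective (a[]-injective (trans
      (sym (proj₂ (aᴵ (xℤ-integral i))))
      (trans (cong ℤ→ℚ (cong proj₁ eq)) (proj₂ (aᴵ (xℤ-integral j)))))))
  , λ j → let xᴵ = xℤ-integral j in
      goodQuartic-integral (aᴵ xᴵ) (bᴵ xᴵ) (cᴵ xᴵ) (dᴵ xᴵ) (goodQuartic-xℤ j)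
  ) ,
  ( (λ j → a[ Real.x j ] , b[ Real.x j ] , c[ Real.x j ] , d[ Real.x j ])
  , (λ eq → xℝ-injective (a[]-injective (cong proj₁ eq)))
  , Real.good
  )
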